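{- Any randomized algorithm in the $\mathsf{CD}$ radio network model that computes with high probability the (global) minimum cut size of unit-disc graphs has energy complexity $\Omega(n)$, where $n$ is the number of vertices.
   Context: Radio network model. A network is a simple connected graph $G=(V,E)$ whose vertices are devices. The topology is initially unknown to the devices, except that $n=|V|$ and the maximum degree $\Delta$ are known to all. Communication proceeds in synchronized rounds with a common start. In each round each device either listens, transmits a message (of unbounded size), or stays idle; it cannot transmit and listen simultaneously. Transmitting and idle devices get no feedback. A listening device $v$ receives the message of $u\in N(v)$ if $u$ is the only transmitting device in $N(v)$. If no device in $N(v)$ transmits, $v$ hears silence. If at least two devices in $N(v)$ transmit, then in the $\mathsf{CD}$ model (with collision detection) $v$ hears "collision". Each device has an unlimited local random source and no other initial distinguishing information (identifiers, if used, are generated from local randomness). The energy complexity of an algorithm is the worst-case maximum, over devices, of the number of rounds in which the device is non-idle (listening or transmitting). "With high probability" means with probability $1-1/\mathrm{poly}(n)$. An algorithm computes a quantity if at the end every device knows it. A cut of $G$ is a partition $(X,V\setminus X)$ with both parts nonempty; its size is the number of edges between the two parts; the minimum cut size is the smallest size of a cut. A unit-disc graph is the intersection graph of unit discs in the plane. -}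

module Defs where

open import Data.Bool.Base using (Bool; true; false; not; _∧_; T)
open import Data.Fin.Base using (Fin; toℕ)
open import Data.Fin.Subset using (Subset; Nonempty; ∁)
import Data.Integer.Base as ℤ
open import Data.List.Base
  using (List; []; _∷_; allFin; cartesianProduct; filterᵇ; foldr; length; map; mapMaybe)
open import Data.List.Membership.Propositional using (_∈_)
open import Data.List.Relation.Unary.Unique.Propositional using (Unique)
open import Data.Maybe.Base using (Maybe; just; nothing)
open import Data.Nat.Base using (ℕ; zero; suc; _+_; _*_; _^_; _⊔_; _≤_; _≥_; NonZero)
open import Data.Nat.Properties using (m^n≢0)
open import Data.Product.Base using (Σ; ∃; ∃-syntax; _×_; _,_)
open import Data.Rational.Unnormalised.Base as ℚ using (ℚᵘ; 0ℚᵘ; 1ℚᵘ)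
open import Data.Vec.Base using (Vec; lookup; tabulate)
open import Function.Bundles using (_⇔_)
open import Relation.Binary.Construct.Closure.ReflexiveTransitive using (Star)
open import Relation.Binary.PropositionalEquality using (_≡_; _≢_)

record Graph (n : ℕ) : Set where
  field
    adj    : Fin n → Fin n → Bool
    sym    : ∀ u v → adj u v ≡ adj v u
    irrefl : ∀ v → adj v v ≡ false

module _ {n : ℕ} (G : Graph n) where
  open Graph G

  Connected : Set
  Connected = ∀ u v → Star (λ x y → T (adj x y)) u v

  degree : Fin n → ℕ
  degree v = length (filterᵇ (adj v) (allFin n))

  maxDegree : ℕ
  maxDegree = foldr _⊔_ 0 (map degree (allFin n))

  -- Ordered pairs, but the first component lies in X and the second outside,
  -- so each edge between the two parts is counted exactly once.
  cutSize : Subset n → ℕ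
  cutSize X = length (filterᵇ crosses (cartesianProduct (allFin n) (allFin n)))
    where
    crosses : Fin n × Fin n → Bool
    crosses (u , v) = lookup X u ∧ not (lookup X v) ∧ adj u v

  IsCut : Subset n → Set
  IsCut X = Nonempty X × Nonempty (∁ X)

  IsMinCutSize : ℕ → Set
  IsMinCutSize k =
    (∃[ X ] (IsCut X × cutSize X ≡ k)) × (∀ X → IsCut X → k ≤ cutSize X)

-- Cauchy reals; statements about them refer to the limit of seq.
record ℝ : Set where
  field
    seq    : ℕ → ℚᵘ
    cauchy : ∀ ε → 0ℚᵘ ℚ.< ε →
             ∃[ N ] (∀ i j → N ≤ i → N ≤ j → ℚ.∣ seq i ℚ.- seq j ∣ ℚ.≤ ε)

Point : Set
Point = ℝ × ℝ

-- The i-th rational approximation of the squared Euclidean distance.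
sqDist : Point → Point → ℕ → ℚᵘ
sqDist (x₁ , y₁) (x₂ , y₂) i = dx ℚ.* dx ℚ.+ dy ℚ.* dy
  where
  dx = ℝ.seq x₁ i ℚ.- ℝ.seq x₂ i
  dy = ℝ.seq y₁ i ℚ.- ℝ.seq y₂ i

-- The point z lies in the closed disc of radius 1 centred at c: the real number
-- represented by sqDist z c is at most 1.
_∈Disc_ : Point → Point → Set
z ∈Disc c = ∀ ε → 0ℚᵘ ℚ.< ε → ∃[ N ] (∀ i → N ≤ i → sqDist z c i ℚ.≤ 1ℚᵘ ℚ.+ ε)

IsUnitDisc : ∀ {n} → Graph n → Set
IsUnitDisc {n} G =
  Σ (Fin n → Point) λ centre → ∀ u v →
    T (Graph.adj G u v) ⇔ (u ≢ v × ∃[ z ] (z ∈Disc centre u × z ∈Disc centre v))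

-- The local random source of one device.
Bits : Set
Bits = ℕ → Bool

-- `halt k` ends the device's participation with output k.
data Action (Msg : Set) : Set where
  idle     : Action Msg
  listen   : Action Msg
  transmit : Msg → Action Msg
  halt     : ℕ → Action Msg

-- `no-feedback` is what a transmitting or idle device perceives.
data Observation (Msg : Set) : Set where
  no-feedback : Observation Msg
  silence     : Observation Msg
  message     : Msg → Observation Msg
  collision   : Observation Msg

-- All devices run the same program. It initially knows only n, Δ and the random
-- bits of the device, which a state may store for later use. There is no
-- restriction on messages, memory or local computation.
record Algorithm : Set₁ where
  field
    Msg    : Set
    State  : Set
    init   : (n Δ : ℕ) → Bits → State
    action : State → Action Msg
    next   : State → Observation Msg → State

module Execution (A : Algorithm) {n : ℕ} (G : Graph n) (ρ : Fin n → Bits) where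
  open Algorithm A
  open Graph G

  sent : Action Msg → Maybe Msg
  sent (transmit m) = just m
  sent _            = nothing

  incoming : (Fin n → State) → Fin n → List Msg
  incoming s v = mapMaybe (λ u → sent (action (s u))) (filterᵇ (adj v) (allFin n))

  hear : List Msg → Observation Msg
  hear []          = silence
  hear (m ∷ [])    = message m
  hear (_ ∷ _ ∷ _) = collision

  update : State → Action Msg → List Msg → State
  update s idle         _  = next s no-feedback
  update s (transmit _) _  = next s no-feedback
  update s listen       ms = next s (hear ms)
  update s (halt _)     _  = s

  -- The states of all devices at the beginning of round t.
  state : ℕ → Fin n → State
  state zero    v = init n (maxDegree G) (ρ v)
  state (suc t) v = update (state t v) (action (state t v)) (incoming (state t) v)

  cost : Action Msg → ℕ
  cost idle         = 0
  cost listen       = 1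
  cost (transmit _) = 1
  cost (halt _)     = 0

  -- The number of rounds before round t in which v is non-idle.
  energy : ℕ → Fin n → ℕ
  energy zero    v = 0
  energy (suc t) v = energy t v + cost (action (state t v))

  -- From some round on, every device has halted and outputs the minimum cut size.
  ComputesMinCut : Set
  ComputesMinCut =
    ∃[ t ] (∀ v → ∃[ k ] (action (state t v) ≡ halt k × IsMinCutSize G k))

prefix : ∀ {n} (k : ℕ) → (Fin n → Bits) → Vec (Vec Bool k) n
prefix k ρ = tabulate λ v → tabulate λ i → ρ v (toℕ i)

-- Pr[S] ≥ p: for every ε > 0, S contains a finite union of cylinders of measure
-- at least p − ε. The cylinders fix the first k bits of each device, so each has
-- measure 1 / 2^(n·k); `good` lists them without repetition. For an event that is
-- always witnessed by finitely many bits (an open set of bit sequences, such as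
-- a given outcome being reached in finite time when every step inspects finitely
-- many bits) this is exactly the inequality for the product measure of S.
ProbabilityAtLeast : ∀ {n} → ((Fin n → Bits) → Set) → ℚᵘ → Set
ProbabilityAtLeast {n} S p = ∀ ε → 0ℚᵘ ℚ.< ε →
  Σ ℕ λ k → Σ (List (Vec (Vec Bool k) n)) λ good →
    Unique good
    × (∀ ρ → prefix k ρ ∈ good → S ρ)
    × p ℚ.- ε ℚ.≤ ((ℤ.+ length good) ℚ./ (2 ^ (n * k))) {{m^n≢0 2 (n * k)}}

UnitDiscNetwork : ∀ {n} → Graph n → Set
UnitDiscNetwork G = Connected G × IsUnitDisc G

-- With high probability: with probability at least 1 − 1/n^c, for some constant
-- c ≥ 1 and all sufficiently large n.
ComputesMinCutWhp : Algorithm → Set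
ComputesMinCutWhp A =
  ∃[ c ] (c ≥ 1 × ∃[ N ] (∀ n .{{_ : NonZero n}} → n ≥ N →
    (G : Graph n) → UnitDiscNetwork G →
    ProbabilityAtLeast (Execution.ComputesMinCut A G)
      (1ℚᵘ ℚ.- (ℤ.1ℤ ℚ./ (n ^ c)) {{m^n≢0 n c}})))

EnergyAtMost : Algorithm → ℕ → ℕ → Set
EnergyAtMost A n b =
  (G : Graph n) → UnitDiscNetwork G → ∀ ρ t v → Execution.energy A G ρ t v ≤ b

-- The energy complexity is at least n / c for a constant c > 0 and all large n.
-- Being a (possibly infinite) supremum, it is compared with n / c through its
-- upper bounds b.
EnergyΩn : Algorithm → Set
EnergyΩn A =
  ∃[ c ] (c ≥ 1 × ∃[ N ] (∀ n → n ≥ N → ∀ b → EnergyAtMost A n b → n ≤ c * b))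

{-# OPTIONS --safe #-}
module Submission where

-- Compare K_n, whose minimum cut has size n - 1, with K_n minus an edge uv, whose
-- minimum cut has size at most n - 2; both are unit-disc graphs with the same
-- maximum degree. The two executions on the same random bits agree until a round
-- in which u listens, v transmits and at most two devices transmit (or the same
-- with u and v exchanged): with three or more transmitters u hears a collision
-- either way. So a listening round of u is sensitive to at most two v, and with
-- energy at most b an execution on K_n is sensitive to at most 2bn ordered pairs.
-- If the algorithm is correct with probability at least 3/4 on every one of these
-- graphs, each pair u ≠ v has to be sensitive, in one of its two orders, with
-- probability at least 1/2; hence n² / 2 ≤ n + 4bn, where the n counts the
-- degenerate pairs u = v, for which K_n minus uv is K_n itself. The averaging is a
-- double count over the bit matrices of one size n × k, common to all pairs.

open import Defs

open import Data.Bool.Base using (Bool; true; false; not; _∧_; T)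
import Data.Bool.Properties as Bool
open import Data.Bool.Properties using (T-∧; T-≡; T-not-≡; ∧-identityʳ; ∧-zeroʳ)
open import Data.Fin.Base using (Fin; zero; suc; fromℕ<; punchIn; punchOut; toℕ)
open import Data.Fin.Properties
  using (_≟_; punchIn-injective; punchIn-punchOut; punchInᵢ≢i)
open import Data.Fin.Subset using (Subset; ⁅_⁆)
open import Data.Fin.Subset.Properties
  using (x∈⁅x⁆; x∈⁅y⁆⇒x≡y; x≢y⇒x∉⁅y⁆; x∉p⇒x∈∁p; x∈∁p⇒x∉p)
import Data.Integer.Base as ℤ
import Data.Integer.Properties as ℤ
open import Data.List.Base
  using ( List; []; _∷_; allFin; cartesianProduct; cartesianProductWith; downFrom
        ; filterᵇ; foldr; length; map; mapMaybe )
open import Data.List.Membership.Propositional using (_∈_; _∉_)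
open import Data.List.Membership.Propositional.Properties
  using ( ∈-allFin; ∈-cartesianProduct⁺; ∈-cartesianProductWith⁺; ∈-cartesianProductWith⁻
        ; ∈-downFrom⁺; ∈-filter⁺; ∈-filter⁻; ∈-map⁺; ∈-map⁻ )
open import Data.List.Properties using (length-++; length-map; length-tabulate)
open import Data.List.Relation.Unary.All as All using (All; []; _∷_)
open import Data.List.Relation.Unary.All.Properties using (¬Any⇒All¬)
open import Data.List.Relation.Unary.AllPairs using ([]; _∷_)
open import Data.List.Relation.Unary.Any using (here; there)
open import Data.List.Relation.Unary.Unique.Propositional using (Unique)
open import Data.List.Relation.Unary.Unique.Propositional.Properties
  using (allFin⁺; cartesianProduct⁺; cartesianProductWith⁺; filter⁺; map⁺)
open import Data.Maybe.Base using (Maybe; just; nothing; is-just)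
open import Data.Nat.Base
open import Data.Nat.Properties hiding (_≟_)
open import Data.Nat.Tactic.RingSolver using (solve-∀)
open import Data.Product.Base using (∃; ∃-syntax; _×_; _,_; proj₁; proj₂)
open import Data.Product.Properties as Product using (,-injectiveˡ; ,-injectiveʳ)
open import Data.Rational.Unnormalised.Base as ℚ using (ℚᵘ; 0ℚᵘ; 1ℚᵘ; *≤*)
import Data.Rational.Unnormalised.Properties as ℚ
open import Data.Sum.Base using (_⊎_; inj₁; inj₂)
open import Data.Vec.Base as Vec using (Vec; []; _∷_; lookup; tabulate; zipWith)
open import Data.Vec.Properties as Vec
  using (++-injective; []=⇒lookup; lookup⇒[]=; tabulate-cong; tabulate∘lookup; ∷-injective)
open import Function.Base using (id; _∘_)
open import Function.Bundles using (_⇔_; mk⇔; Equivalence)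
open import Relation.Binary.Construct.Closure.ReflexiveTransitive as Star using (Star; _◅_)
open import Relation.Binary.Definitions using (DecidableEquality)
open import Relation.Binary.PropositionalEquality
open import Relation.Nullary
open import Relation.Nullary.Decidable
  using (True; T?; dec-true; dec-false; does-⇔; from-yes; fromWitness; isYes; isYes≗does; toWitness)

-- Finite sums over lists and counting without repetition.

𝟙 : Bool → ℕ
𝟙 false = 0
𝟙 true  = 1

𝟙≤1 : ∀ b → 𝟙 b ≤ 1
𝟙≤1 false = z≤n
𝟙≤1 true  = ≤-refl

module _ {A : Set} where

  ∑ : List A → (A → ℕ) → ℕ
  ∑ []       f = 0
  ∑ (x ∷ xs) f = f x + ∑ xs f

  syntax ∑ xs (λ x → e) = ∑[ x ∈ xs ] e

  ∑-cong : ∀ {f g} xs → (∀ x → f x ≡ g x) → ∑ xs f ≡ ∑ xs g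
  ∑-cong []       f≗g = refl
  ∑-cong (x ∷ xs) f≗g = cong₂ _+_ (f≗g x) (∑-cong xs f≗g)

  ∑-mono-∈ : ∀ {f g} xs → (∀ {x} → x ∈ xs → f x ≤ g x) → ∑ xs f ≤ ∑ xs g
  ∑-mono-∈ []       f≤g = z≤n
  ∑-mono-∈ (x ∷ xs) f≤g = +-mono-≤ (f≤g (here refl)) (∑-mono-∈ xs (f≤g ∘ there))

  ∑-mono : ∀ {f g} xs → (∀ x → f x ≤ g x) → ∑ xs f ≤ ∑ xs g
  ∑-mono xs f≤g = ∑-mono-∈ xs λ {x} _ → f≤g x

  ∑-distrib-+ : ∀ f g xs → ∑[ x ∈ xs ] (f x + g x) ≡ ∑ xs f + ∑ xs g
  ∑-distrib-+ f g []       = refl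
  ∑-distrib-+ f g (x ∷ xs) = trans (cong (f x + g x +_) (∑-distrib-+ f g xs))
    (interchange (f x) (g x) (∑ xs f) (∑ xs g))
    where
    interchange : ∀ a b c d → a + b + (c + d) ≡ a + c + (b + d)
    interchange = solve-∀

  ∑-const : ∀ c xs → ∑[ _ ∈ xs ] c ≡ length xs * c
  ∑-const c []       = refl
  ∑-const c (x ∷ xs) = cong (c +_) (∑-const c xs)

  *-distribˡ-∑ : ∀ c f xs → ∑[ x ∈ xs ] (c * f x) ≡ c * ∑ xs f
  *-distribˡ-∑ c f []       = sym (*-zeroʳ c)
  *-distribˡ-∑ c f (x ∷ xs) = trans (cong (c * f x +_) (*-distribˡ-∑ c f xs))
    (sym (*-distribˡ-+ c (f x) (∑ xs f)))

  ∑-≤-const : ∀ {f} c xs → (∀ x → f x ≤ c) → ∑ xs f ≤ length xs * c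
  ∑-≤-const c xs f≤c = ≤-trans (∑-mono xs f≤c) (≤-reflexive (∑-const c xs))

  ∑-zero : ∀ {f} xs → (∀ x → f x ≡ 0) → ∑ xs f ≡ 0
  ∑-zero []       f≡0 = refl
  ∑-zero (x ∷ xs) f≡0 = cong₂ _+_ (f≡0 x) (∑-zero xs f≡0)

  ∈⇒≤∑ : ∀ f {x xs} → x ∈ xs → f x ≤ ∑ xs f
  ∈⇒≤∑ f {xs = x ∷ xs} (here refl) = m≤m+n (f x) (∑ xs f)
  ∈⇒≤∑ f {xs = y ∷ xs} (there x∈)  = ≤-trans (∈⇒≤∑ f x∈) (m≤n+m _ (f y))

∑-comm : ∀ {A B : Set} (f : A → B → ℕ) xs ys →
         ∑[ x ∈ xs ] ∑[ y ∈ ys ] f x y ≡ ∑[ y ∈ ys ] ∑[ x ∈ xs ] f x y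
∑-comm f []       ys = sym (∑-zero ys λ _ → refl)
∑-comm f (x ∷ xs) ys = trans (cong (∑ ys (f x) +_) (∑-comm f xs ys))
  (sym (∑-distrib-+ (f x) (λ y → ∑[ x ∈ xs ] f x y) ys))

module Counting {A : Set} (_≟_ : DecidableEquality A) where

  -- For a duplicate-free `xs` this is the indicator of membership in `xs`, in a form that can be
  -- summed and whose sums can be interchanged.
  count : A → List A → ℕ
  count x xs = ∑[ y ∈ xs ] 𝟙 (does (y ≟ x))

  count-∉ : ∀ {x xs} → All (x ≢_) xs → count x xs ≡ 0
  count-∉ []                   = refl
  count-∉ {x} {y ∷ xs} (x≢y ∷ x∉) with y ≟ x
  ... | yes refl = contradiction refl x≢y
  ... | no _     = count-∉ x∉

  count-unique : ∀ {xs} → Unique xs → ∀ x → count x xs ≤ 1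
  count-unique []                     x = z≤n
  count-unique {y ∷ xs} (y∉ ∷ unique) x with y ≟ x
  ... | yes refl = s≤s (≤-reflexive (count-∉ y∉))
  ... | no _     = count-unique unique x

  count-positive : ∀ x xs → 0 < count x xs → x ∈ xs
  count-positive x (y ∷ xs) pos with y ≟ x
  ... | yes refl = here refl
  ... | no _     = there (count-positive x xs pos)

  -- Both sides count matching pairs from `xs` and `ys`: each entry of `xs` has at least one partner
  -- in `ys`, and interchanging the sums groups the pairs by that partner.
  length≤∑count : ∀ xs ys → (∀ {x} → x ∈ xs → x ∈ ys) →
                  length xs ≤ ∑[ y ∈ ys ] count y xs
  length≤∑count xs ys xs⊆ys = begin
    length xs                                          ≡⟨ *-identityʳ _ ⟨
    length xs * 1                                      ≡⟨ ∑-const 1 xs ⟨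
    ∑[ _ ∈ xs ] 1                                      ≤⟨ ∑-mono-∈ xs 1≤ ⟩
    ∑[ x ∈ xs ] ∑[ y ∈ ys ] 𝟙 (does (x ≟ y))           ≡⟨ ∑-comm _ xs ys ⟩
    ∑[ y ∈ ys ] count y xs                             ∎
    where
    open ≤-Reasoning
    1≤ : ∀ {x} → x ∈ xs → 1 ≤ ∑[ y ∈ ys ] 𝟙 (does (x ≟ y))
    1≤ {x} x∈ = ≤-trans
      (≤-reflexive (cong 𝟙 (sym (dec-true (x ≟ x) refl))))
      (∈⇒≤∑ (λ y → 𝟙 (does (x ≟ y))) (xs⊆ys x∈))

  unique-⊆⇒length≤ : ∀ {xs ys} → Unique xs → (∀ {x} → x ∈ xs → x ∈ ys) →
                     length xs ≤ length ys
  unique-⊆⇒length≤ {xs} {ys} unique xs⊆ys = begin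
    length xs               ≤⟨ length≤∑count xs ys xs⊆ys ⟩
    ∑[ y ∈ ys ] count y xs  ≤⟨ ∑-≤-const 1 ys (count-unique unique) ⟩
    length ys * 1           ≡⟨ *-identityʳ _ ⟩
    length ys               ∎
    where open ≤-Reasoning

length-allFin : ∀ n → length (allFin n) ≡ n
length-allFin n = length-tabulate id

module _ {A : Set} where

  ∈-filterᵇ⁺ : ∀ p {x : A} {xs} → x ∈ xs → T (p x) → x ∈ filterᵇ p xs
  ∈-filterᵇ⁺ p = ∈-filter⁺ (T? ∘ p)

  ∈-filterᵇ⁻ : ∀ p xs {x : A} → x ∈ filterᵇ p xs → x ∈ xs × T (p x)
  ∈-filterᵇ⁻ p xs = ∈-filter⁻ (T? ∘ p)

isYes-⇔ : ∀ {A B : Set} → A ⇔ B → (a? : Dec A) (b? : Dec B) → isYes a? ≡ isYes b?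
isYes-⇔ A⇔B a? b? = trans (isYes≗does a?) (trans (does-⇔ A⇔B a? b?) (sym (isYes≗does b?)))

max-≤ : ∀ {b} xs → All (_≤ b) xs → foldr _⊔_ 0 xs ≤ b
max-≤ []       []         = z≤n
max-≤ (x ∷ xs) (px ∷ pxs) = ⊔-lub px (max-≤ xs pxs)

≤-max : ∀ {x} xs → x ∈ xs → x ≤ foldr _⊔_ 0 xs
≤-max (x ∷ xs) (here refl) = m≤m⊔n x _
≤-max (y ∷ xs) (there x∈)  = ≤-trans (≤-max xs x∈) (m≤n⊔m y _)

-- Degrees and cut sizes of graphs.

module _ {n : ℕ} (G : Graph n) where
  open Graph G using (adj; irrefl)

  -- A copy of the predicate local to `cutSize`, so that it can be named; the two agree
  -- definitionally.
  crosses : Subset n → Fin n × Fin n → Bool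
  crosses X (x , y) = lookup X x ∧ not (lookup X y) ∧ adj x y

  crossing : Subset n → List (Fin n × Fin n)
  crossing X = filterᵇ (crosses X) (cartesianProduct (allFin n) (allFin n))

  cutSize≡length-crossing : ∀ X → cutSize G X ≡ length (crossing X)
  cutSize≡length-crossing X = refl

  ∈-crossing⁺ : ∀ X x y → T (crosses X (x , y)) → (x , y) ∈ crossing X
  ∈-crossing⁺ X x y = ∈-filterᵇ⁺ (crosses X) (∈-cartesianProduct⁺ (∈-allFin x) (∈-allFin y))

  ∈-crossing⁻ : ∀ X {e} → e ∈ crossing X → T (crosses X e)
  ∈-crossing⁻ X e∈ =
    proj₂ (∈-filterᵇ⁻ (crosses X) (cartesianProduct (allFin n) (allFin n)) e∈)

degree< : ∀ {n} (G : Graph n) x → degree G x < n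
degree< {n} G x = ≤-trans (Counting.unique-⊆⇒length≤ _≟_ unique (λ _ → ∈-allFin _))
                          (≤-reflexive (length-allFin n))
  where
  open Graph G using (adj)
  x∉ : x ∉ filterᵇ (adj x) (allFin n)
  x∉ x∈ = subst T (Graph.irrefl G x) (proj₂ (∈-filterᵇ⁻ (adj x) (allFin n) x∈))
  unique : Unique (x ∷ filterᵇ (adj x) (allFin n))
  unique = ¬Any⇒All¬ _ x∉ ∷ filter⁺ (T? ∘ adj x) (allFin⁺ n)

-- The bound of `degree<` is attained at `w`: `punchIn w` lists the other vertices, all of them
-- neighbours of `w`. The form with `suc` avoids truncated subtraction.
universal⇒maxDegree : ∀ {n} (G : Graph n) w →
  (∀ x → w ≢ x → T (Graph.adj G w x)) → suc (maxDegree G) ≡ n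
universal⇒maxDegree {suc m} G w universal = cong suc (≤-antisym
  (max-≤ _ (All.tabulate below))
  (≤-trans m≤degree (≤-max _ (∈-map⁺ (degree G) (∈-allFin w)))))
  where
  open Graph G using (adj)
  open ≤-Reasoning
  below : ∀ {d} → d ∈ map (degree G) (allFin (suc m)) → d ≤ m
  below d∈ with x , _ , refl ← ∈-map⁻ (degree G) d∈ = s≤s⁻¹ (degree< G x)
  neighbour : ∀ {x} → x ∈ map (punchIn w) (allFin m) →
              x ∈ filterᵇ (adj w) (allFin (suc m))
  neighbour x∈ with y , _ , refl ← ∈-map⁻ (punchIn w) x∈ =
    ∈-filterᵇ⁺ (adj w) (∈-allFin _) (universal _ (punchInᵢ≢i w y ∘ sym))
  m≤degree : m ≤ degree G w
  m≤degree = begin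
    m                                       ≡⟨ length-allFin m ⟨
    length (allFin m)                       ≡⟨ length-map (punchIn w) (allFin m) ⟨
    length (map (punchIn w) (allFin m))     ≤⟨ Counting.unique-⊆⇒length≤ _≟_
                                                 (map⁺ (punchIn-injective w _ _) (allFin⁺ m))
                                                 neighbour ⟩
    degree G w                              ∎

-- With a ∈ X and b ∉ X, every vertex w ≠ a contributes the crossing edge wb
-- or aw, and these n - 1 edges are distinct.
complete⇒n≤1+cutSize : ∀ {n} (G : Graph n) → (∀ x y → x ≢ y → T (Graph.adj G x y)) →
  ∀ X → IsCut G X → n ≤ 1 + cutSize G X
complete⇒n≤1+cutSize {suc m} G complete X ((a , a∈X) , (b , b∈∁X)) = s≤s (begin
  m                                ≡⟨ length-allFin m ⟨
  length (allFin m)                ≡⟨ length-map edge (allFin m) ⟨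
  length (map edge (allFin m))     ≤⟨ Counting.unique-⊆⇒length≤ (Product.≡-dec _≟_ _≟_)
                                        (map⁺ (edge-injective _ _) (allFin⁺ m)) edge-crosses ⟩
  length (crossing G X)            ≡⟨ cutSize≡length-crossing G X ⟨
  cutSize G X                      ∎)
  where
  open ≤-Reasoning

  Xa : lookup X a ≡ true
  Xa = []=⇒lookup a∈X

  Xb : lookup X b ≡ false
  Xb with lookup X b in eq
  ... | true  = contradiction (lookup⇒[]= b X eq) (x∈∁p⇒x∉p b∈∁X)
  ... | false = refl

  edge : Fin m → Fin (suc m) × Fin (suc m)
  edge i with lookup X (punchIn a i)
  ... | true  = punchIn a i , b
  ... | false = a , punchIn a i

  edge-injective : ∀ i j → edge i ≡ edge j → i ≡ j
  edge-injective i j eq with lookup X (punchIn a i) | lookup X (punchIn a j)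
  ... | true  | true  = punchIn-injective a i j (,-injectiveˡ eq)
  ... | false | false = punchIn-injective a i j (,-injectiveʳ eq)
  -- Edges of different kinds differ in the first component, which is `a` for one kind only.
  ... | true  | false = contradiction (,-injectiveˡ eq) (punchInᵢ≢i a i)
  ... | false | true  = contradiction (sym (,-injectiveˡ eq)) (punchInᵢ≢i a j)

  crossing-edge : ∀ x y → lookup X x ≡ true → lookup X y ≡ false → (x , y) ∈ crossing G X
  crossing-edge x y Xx Xy = ∈-crossing⁺ G X x y (Equivalence.from T-∧
    ( Equivalence.from T-≡ Xx
    , Equivalence.from T-∧ (Equivalence.from T-not-≡ Xy , complete x y λ { refl →
        contradiction (trans (sym Xx) Xy) λ () })))

  edge-crosses : ∀ {e} → e ∈ map edge (allFin m) → e ∈ crossing G X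
  edge-crosses e∈ with i , _ , refl ← ∈-map⁻ edge e∈
    with lookup X (punchIn a i) in eq
  ... | true  = crossing-edge (punchIn a i) b eq Xb
  ... | false = crossing-edge a (punchIn a i) Xa eq

module _ {n : ℕ} (G : Graph n) where
  open Graph G using (adj; irrefl)

  singleton-cut : ∀ {u v} → u ≢ v → IsCut G ⁅ u ⁆
  singleton-cut {u} {v} u≢v =
    (u , x∈⁅x⁆ u) , (v , x∉p⇒x∈∁p (x≢y⇒x∉⁅y⁆ (u≢v ∘ sym)))

  -- Every edge leaving `⁅ u ⁆` is one of the `n` pairs that start with `u`, and the pairs `(u , u)`
  -- and `(u , v)` are not edges.
  non-neighbour⇒cutSize≤ : ∀ {u v} → u ≢ v → ¬ T (adj u v) → 2 + cutSize G ⁅ u ⁆ ≤ n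
  non-neighbour⇒cutSize≤ {u} {v} u≢v ¬uv = begin
    2 + cutSize G ⁅ u ⁆                 ≡⟨ cong (2 +_) (cutSize≡length-crossing G ⁅ u ⁆) ⟩
    2 + length edges                    ≤⟨ Counting.unique-⊆⇒length≤ (Product.≡-dec _≟_ _≟_)
                                             unique ⊆star ⟩
    length (map (u ,_) (allFin n))      ≡⟨ length-map (u ,_) (allFin n) ⟩
    length (allFin n)                   ≡⟨ length-allFin n ⟩
    n                                   ∎
    where
    open ≤-Reasoning
    edges = crossing G ⁅ u ⁆

    edge : ∀ {x y} → (x , y) ∈ edges → x ≡ u × T (adj x y)
    edge {x} {y} e∈
      with Xx , rest ← Equivalence.to T-∧ (∈-crossing⁻ G ⁅ u ⁆ e∈)
      with _ , xy ← Equivalence.to T-∧ rest =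
      x∈⁅y⁆⇒x≡y u (lookup⇒[]= x ⁅ u ⁆ (Equivalence.to T-≡ Xx)) , xy

    uu∉ : (u , u) ∉ edges
    uu∉ e∈ = subst T (irrefl u) (proj₂ (edge e∈))

    uv∉ : (u , v) ∉ edges
    uv∉ e∈ = ¬uv (proj₂ (edge e∈))

    unique : Unique ((u , u) ∷ (u , v) ∷ edges)
    unique = ((u≢v ∘ ,-injectiveʳ) ∷ ¬Any⇒All¬ _ uu∉) ∷ ¬Any⇒All¬ _ uv∉
           ∷ filter⁺ (T? ∘ crosses G ⁅ u ⁆) (cartesianProduct⁺ (allFin⁺ n) (allFin⁺ n))

    ⊆star : ∀ {e} → e ∈ (u , u) ∷ (u , v) ∷ edges → e ∈ map (u ,_) (allFin n)
    ⊆star (here refl)         = ∈-map⁺ (u ,_) (∈-allFin u)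
    ⊆star (there (here refl)) = ∈-map⁺ (u ,_) (∈-allFin v)
    ⊆star {x , y} (there (there e∈)) with refl , _ ← edge e∈ = ∈-map⁺ (u ,_) (∈-allFin y)

-- The complete graph with one edge removed.

module _ {n : ℕ} where

  Joined : (u v x y : Fin n) → Set
  Joined u v x y = x ≢ y × ¬ (x ≡ u × y ≡ v) × ¬ (x ≡ v × y ≡ u)

  joined? : ∀ u v x y → Dec (Joined u v x y)
  joined? u v x y = ¬? (x ≟ y) ×-dec ¬? (x ≟ u ×-dec y ≟ v) ×-dec ¬? (x ≟ v ×-dec y ≟ u)

  joined-sym : ∀ {u v x y} → Joined u v x y → Joined u v y x
  joined-sym (x≢y , ¬uv , ¬vu) = x≢y ∘ sym , (λ (p , q) → ¬vu (q , p)) , λ (p , q) → ¬uv (q , p)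

  -- For `u ≡ v` only the diagonal is excluded, so `completeMinus o o` serves as the complete graph
  -- and one family covers both kinds of network.
  completeMinus : (u v : Fin n) → Graph n
  completeMinus u v = record
    { adj    = λ x y → isYes (joined? u v x y)
    ; sym    = λ x y → isYes-⇔ (mk⇔ joined-sym joined-sym) (joined? u v x y) (joined? u v y x)
    ; irrefl = λ x → trans (isYes≗does (joined? u v x x))
                       (dec-false (joined? u v x x) λ (x≢x , _) → x≢x refl)
    }

  module _ {u v x y : Fin n} where

    joined⇒adj : Joined u v x y → T (Graph.adj (completeMinus u v) x y)
    joined⇒adj = fromWitness {a? = joined? u v x y}

    adj⇒joined : T (Graph.adj (completeMinus u v) x y) → Joined u v x y
    adj⇒joined = toWitness {a? = joined? u v x y}

completeMinus-complete : ∀ {n} (o x y : Fin n) → x ≢ y → T (Graph.adj (completeMinus o o) x y)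
completeMinus-complete o x y x≢y =
  joined⇒adj (x≢y , (λ { (refl , refl) → x≢y refl }) , λ { (refl , refl) → x≢y refl })

third-vertex : ∀ {n} → 3 ≤ n → (u v : Fin n) → ∃[ w ] (w ≢ u × w ≢ v)
third-vertex (s≤s (s≤s (s≤s _))) u v with u ≟ v
... | yes refl = punchIn u zero , punchInᵢ≢i u zero , punchInᵢ≢i u zero
-- `punchOut u≢v` is the position of `v` among the vertices other than `u`; the witness avoids this
-- position first and `u` afterwards.
... | no u≢v   = punchIn u w , punchInᵢ≢i u w , λ eq → punchInᵢ≢i (punchOut u≢v) zero
                   (punchIn-injective u w (punchOut u≢v) (trans eq (sym (punchIn-punchOut u≢v))))
  where
  w = punchIn (punchOut u≢v) zero

module _ {n : ℕ} (3≤n : 3 ≤ n) (u v : Fin n) where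

  private
    w   = proj₁ (third-vertex 3≤n u v)
    w≢u = proj₁ (proj₂ (third-vertex 3≤n u v))
    w≢v = proj₂ (proj₂ (third-vertex 3≤n u v))

  -- The vertex `w` is no endpoint of the missing edge. This one universal vertex yields both the
  -- maximum degree and connectedness by paths through `w`.
  third-universal : ∀ x → w ≢ x → Joined u v w x
  third-universal x w≢x = w≢x , (λ (w≡u , _) → w≢u w≡u) , λ (w≡v , _) → w≢v w≡v

  -- The value does not depend on `u` and `v`, so the initial knowledge of Δ does not reveal which
  -- edge, if any, is missing.
  completeMinus-maxDegree : suc (maxDegree (completeMinus u v)) ≡ n
  completeMinus-maxDegree =
    universal⇒maxDegree (completeMinus u v) w λ x → joined⇒adj ∘ third-universal x

  completeMinus-connected : Connected (completeMinus u v)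
  completeMinus-connected x y = to-third x (from-third y)
    where
    _⟶*_ = Star (λ x y → T (Graph.adj (completeMinus u v) x y))
    from-third : ∀ y → w ⟶* y
    from-third y with w ≟ y
    ... | yes refl = Star.ε
    ... | no w≢y   = joined⇒adj (third-universal y w≢y) ◅ Star.ε
    to-third : ∀ x {y} → w ⟶* y → x ⟶* y
    to-third x path with w ≟ x
    ... | yes refl = path
    ... | no w≢x   = joined⇒adj (joined-sym (third-universal x w≢x)) ◅ path

-- A common value `k` would satisfy `n ≤ 1 + k` by the complete graph, and `2 + k ≤ n` by the cut
-- `⁅ u ⁆` of the other graph.
minCutSize-differs : ∀ {n k} {u v : Fin n} → u ≢ v → ∀ (o : Fin n) →
  IsMinCutSize (completeMinus o o) k → ¬ IsMinCutSize (completeMinus u v) k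
minCutSize-differs {n} {k} {u} {v} u≢v o ((X , cut , refl) , _) (_ , minimal) =
  <-irrefl refl (begin-strict
    n
      ≤⟨ complete⇒n≤1+cutSize (completeMinus o o) (completeMinus-complete o) X cut ⟩
    1 + k
      ≤⟨ s≤s (minimal ⁅ u ⁆ (singleton-cut (completeMinus u v) u≢v)) ⟩
    1 + cutSize (completeMinus u v) ⁅ u ⁆
      <⟨ non-neighbour⇒cutSize≤ (completeMinus u v) u≢v
           (λ uv → proj₁ (proj₂ (adj⇒joined uv)) (refl , refl)) ⟩
    n ∎)
  where open ≤-Reasoning

-- Sensitive rounds and the comparison of two executions.

module _ {A B : Set} where

  -- The filters may disagree where no value is produced: an edge to a device that does not transmit
  -- has no effect on the incoming messages.
  mapMaybe-filterᵇ-cong : ∀ {f g : A → Maybe B} {p q : A → Bool} →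
    (∀ x → f x ≡ g x) → (∀ x → g x ≡ nothing ⊎ p x ≡ q x) →
    ∀ xs → mapMaybe f (filterᵇ p xs) ≡ mapMaybe g (filterᵇ q xs)
  mapMaybe-filterᵇ-cong                 f≗g p≗q []       = refl
  mapMaybe-filterᵇ-cong {f} {g} {p} {q} f≗g p≗q (x ∷ xs)
    with ih ← mapMaybe-filterᵇ-cong f≗g p≗q xs | p x | q x | p≗q x
  ... | false | false | _         = ih
  ... | true  | false | inj₁ none rewrite f≗g x | none = ih
  ... | false | true  | inj₁ none rewrite none = ih
  ... | true  | true  | _         rewrite f≗g x with g x
  ...   | just y  = cong (y ∷_) ih
  ...   | nothing = ih

  length-mapMaybe-filterᵇ : ∀ (f : A → Maybe B) p xs →
    length (mapMaybe f (filterᵇ p xs)) ≡ ∑[ x ∈ xs ] 𝟙 (p x ∧ is-just (f x))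
  length-mapMaybe-filterᵇ f p []       = refl
  length-mapMaybe-filterᵇ f p (x ∷ xs) with p x
  ... | false = length-mapMaybe-filterᵇ f p xs
  ... | true with f x
  ...   | just _  = cong suc (length-mapMaybe-filterᵇ f p xs)
  ...   | nothing = length-mapMaybe-filterᵇ f p xs

module _ (A : Algorithm) where
  open Algorithm A

  listens : Action Msg → Bool
  listens listen = true
  listens _      = false

  module Receiving {n} (H : Graph n) (ρ : Fin n → Bits) where
    open Execution A H ρ
    open Graph H using (adj)

    transmits : Action Msg → Bool
    transmits a = is-just (sent a)

    hear-collision : ∀ ms → 2 ≤ length ms → hear ms ≡ collision
    hear-collision (_ ∷ [])    (s≤s ())
    hear-collision (_ ∷ _ ∷ _) _ = refl

    -- Deleting the edge wp changes what w perceives only if w listens, p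
    -- transmits and at most two messages arrive at w.
    sensitive : (Fin n → State) → Fin n → Fin n → ℕ
    sensitive σ w p =
      𝟙 (listens (action (σ w)) ∧ transmits (action (σ p)) ∧ (length (incoming σ w) ≤ᵇ 2))

    -- In a complete graph every transmitter other than `w` is heard by `w`, so when at most two
    -- messages arrive at a listening `w` there are at most two sensitive `p`. In all other
    -- situations the sum vanishes.
    ∑-sensitive : (∀ x y → x ≢ y → T (adj x y)) → ∀ σ w →
                  ∑[ p ∈ allFin n ] sensitive σ w p ≤ 2 * cost (action (σ w))
    ∑-sensitive complete σ w with action (σ w) in eq
    ... | idle       = ≤-reflexive (∑-zero (allFin n) λ _ → refl)
    ... | transmit _ = ≤-trans (≤-reflexive (∑-zero (allFin n) λ _ → refl)) z≤n
    ... | halt _     = ≤-reflexive (∑-zero (allFin n) λ _ → refl)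
    ... | listen with length (incoming σ w) ≤ᵇ 2 in few
    ...   | false = ≤-trans (≤-reflexive (∑-zero (allFin n) λ p →
                      cong 𝟙 (∧-zeroʳ (transmits (action (σ p)))))) z≤n
    ...   | true  = begin
      ∑[ p ∈ allFin n ] 𝟙 (transmits (action (σ p)) ∧ true)
        ≤⟨ ∑-mono (allFin n) heard ⟩
      ∑[ p ∈ allFin n ] 𝟙 (adj w p ∧ transmits (action (σ p)))
        ≡⟨ length-mapMaybe-filterᵇ (λ p → sent (action (σ p))) (adj w) (allFin n) ⟨
      length (incoming σ w)
        ≤⟨ ≤ᵇ⇒≤ _ 2 (subst T (sym few) _) ⟩
      2 ∎
      where
      open ≤-Reasoning
      heard : ∀ p → 𝟙 (transmits (action (σ p)) ∧ true) ≤ 𝟙 (adj w p ∧ transmits (action (σ p)))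
      heard p with w ≟ p
      -- The device `w` is not its own neighbour, but it listens and hence does not transmit.
      ... | yes refl rewrite eq = z≤n
      ... | no w≢p with adj w p | complete w p w≢p
      ...   | true | _ = ≤-reflexive (cong 𝟙 (∧-identityʳ _))

    ∑-cost : ∀ t v → ∑[ s ∈ downFrom t ] cost (action (state s v)) ≡ energy t v
    ∑-cost zero    v = refl
    ∑-cost (suc t) v = trans (cong (cost (action (state t v)) +_) (∑-cost t v))
                             (+-comm _ (energy t v))

    sensitivity : ℕ → Fin n → Fin n → ℕ
    sensitivity t u v = ∑[ s ∈ downFrom t ] sensitive (state s) u v

    -- For fixed `u`, summing over `v` inside each round charges at most 2 to every non-idle round
    -- of `u`, of which there are at most `b`.
    ∑∑-sensitivity : (∀ x y → x ≢ y → T (adj x y)) → ∀ {b} t → (∀ v → energy t v ≤ b) →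
                     ∑[ u ∈ allFin n ] ∑[ v ∈ allFin n ] sensitivity t u v ≤ n * (2 * b)
    ∑∑-sensitivity complete {b} t energy≤b = begin
      ∑[ u ∈ allFin n ] ∑[ v ∈ allFin n ] sensitivity t u v
        ≤⟨ ∑-≤-const (2 * b) (allFin n) row ⟩
      length (allFin n) * (2 * b)
        ≡⟨ cong (_* (2 * b)) (length-allFin n) ⟩
      n * (2 * b) ∎
      where
      open ≤-Reasoning
      row : ∀ u → ∑[ v ∈ allFin n ] sensitivity t u v ≤ 2 * b
      row u = begin
        ∑[ v ∈ allFin n ] sensitivity t u v
          ≡⟨ ∑-comm (λ v s → sensitive (state s) u v) (allFin n) (downFrom t) ⟩
        ∑[ s ∈ downFrom t ] ∑[ v ∈ allFin n ] sensitive (state s) u v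
          ≤⟨ ∑-mono (downFrom t) (λ s → ∑-sensitive complete (state s) u) ⟩
        ∑[ s ∈ downFrom t ] (2 * cost (action (state s u)))
          ≡⟨ *-distribˡ-∑ 2 (λ s → cost (action (state s u))) (downFrom t) ⟩
        2 * ∑[ s ∈ downFrom t ] cost (action (state s u))
          ≡⟨ cong (2 *_) (∑-cost t u) ⟩
        2 * energy t u
          ≤⟨ *-monoʳ-≤ 2 (energy≤b u) ⟩
        2 * b ∎

    -- `update` freezes the state of a halted device. Outputs reached at different times thereby
    -- become comparable.
    halt-stable : ∀ t {v k} → action (state t v) ≡ halt k → ∀ d → action (state (d + t) v) ≡ halt k
    halt-stable t         halted zero    = halted
    halt-stable t {v} {k} halted (suc d) = trans (cong action frozen) (halt-stable t halted d)
      where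
      frozen : state (suc d + t) v ≡ state (d + t) v
      frozen = cong (λ a → update (state (d + t) v) a (incoming (state (d + t)) v))
                    (halt-stable t halted d)

  -- In the application `H` is complete and `G` lacks the edge between `u` and `v`. Sensitivity is
  -- measured in the execution on `H` alone, so one execution serves for all choices of the edge.
  module Compare {n} (H G : Graph n) (ρ : Fin n → Bits)
    (sameΔ : maxDegree H ≡ maxDegree G) (u v : Fin n)
    (agree : ∀ x y → ¬ (x ≡ u × y ≡ v) → ¬ (x ≡ v × y ≡ u) → Graph.adj H x y ≡ Graph.adj G x y)
    where

    private
      module EH = Execution A H ρ
      module EG = Execution A G ρ
    open Receiving H ρ using (sensitive; sensitivity)

    -- The result does not involve the graph, but the two instances of the parametrised module
    -- become equal only after a case split on the action.
    sent-≡ : ∀ a → EG.sent a ≡ EH.sent a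
    sent-≡ idle         = refl
    sent-≡ listen       = refl
    sent-≡ (transmit _) = refl
    sent-≡ (halt _)     = refl

    update-≡ : ∀ s a ms → EG.update s a ms ≡ EH.update s a ms
    update-≡ s idle         ms          = refl
    update-≡ s listen       []          = refl
    update-≡ s listen       (_ ∷ [])    = refl
    update-≡ s listen       (_ ∷ _ ∷ _) = refl
    update-≡ s (transmit _) ms          = refl
    update-≡ s (halt _)     ms          = refl

    incoming-cong : ∀ {σ τ : Fin n → State} → (∀ x → τ x ≡ σ x) → ∀ w →
      (∀ x → EH.sent (action (σ x)) ≡ nothing ⊎ Graph.adj G w x ≡ Graph.adj H w x) →
      EG.incoming τ w ≡ EH.incoming σ w
    incoming-cong {σ} {τ} τ≗σ w same = mapMaybe-filterᵇ-cong
      (λ x → trans (sent-≡ (action (τ x))) (cong (EH.sent ∘ action) (τ≗σ x))) same (allFin n)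

    -- Only the message of `p` can be lost, and `p` occurs once among the vertices.
    length-incoming : ∀ {σ τ : Fin n → State} → (∀ x → τ x ≡ σ x) → ∀ w p →
      (∀ x → x ≢ p → Graph.adj G w x ≡ Graph.adj H w x) →
      length (EH.incoming σ w) ≤ 1 + length (EG.incoming τ w)
    length-incoming {σ} {τ} τ≗σ w p same = begin
      length (EH.incoming σ w)
        ≡⟨ length-mapMaybe-filterᵇ (EH.sent ∘ action ∘ σ) (Graph.adj H w) (allFin n) ⟩
      ∑[ x ∈ allFin n ] 𝟙 (Graph.adj H w x ∧ is-just (EH.sent (action (σ x))))
        ≤⟨ ∑-mono (allFin n) pointwise ⟩
      ∑[ x ∈ allFin n ] (𝟙 (does (x ≟ p)) + 𝟙 (Graph.adj G w x ∧ is-just (EG.sent (action (τ x)))))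
        ≡⟨ ∑-distrib-+ (λ x → 𝟙 (does (x ≟ p))) _ (allFin n) ⟩
      count p (allFin n) + ∑[ x ∈ allFin n ] 𝟙 (Graph.adj G w x ∧ is-just (EG.sent (action (τ x))))
        ≤⟨ +-monoˡ-≤ _ (count-unique (allFin⁺ n) p) ⟩
      1 + ∑[ x ∈ allFin n ] 𝟙 (Graph.adj G w x ∧ is-just (EG.sent (action (τ x))))
        ≡⟨ cong suc (length-mapMaybe-filterᵇ (EG.sent ∘ action ∘ τ) (Graph.adj G w) (allFin n)) ⟨
      1 + length (EG.incoming τ w) ∎
      where
      open ≤-Reasoning
      open Counting (_≟_ {n})
      pointwise : ∀ x → 𝟙 (Graph.adj H w x ∧ is-just (EH.sent (action (σ x))))
                      ≤ 𝟙 (does (x ≟ p)) + 𝟙 (Graph.adj G w x ∧ is-just (EG.sent (action (τ x))))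
      pointwise x with x ≟ p
      ... | yes _  = ≤-trans (𝟙≤1 _) (m≤m+n 1 _)
      ... | no x≢p rewrite same x x≢p | sent-≡ (action (τ x)) | τ≗σ x = ≤-refl

    -- A device that does not listen ignores its messages. If it listens and `p` is silent, the
    -- incoming lists coincide. If `p` transmits, insensitivity forces at least three messages in
    -- `H`, hence at least two in `G`: a collision in both.
    receive : ∀ {σ τ : Fin n → State} → (∀ x → τ x ≡ σ x) → ∀ w p →
      (∀ x → x ≢ p → Graph.adj G w x ≡ Graph.adj H w x) → sensitive σ w p ≡ 0 →
      EH.update (σ w) (action (σ w)) (EG.incoming τ w) ≡
      EH.update (σ w) (action (σ w)) (EH.incoming σ w)
    receive {σ} {τ} τ≗σ w p same insensitive with action (σ w)
    ... | idle       = refl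
    ... | transmit _ = refl
    ... | halt _     = refl
    ... | listen with EH.sent (action (σ p)) in sentp
    ...   | nothing = cong (next (σ w) ∘ EH.hear) (incoming-cong τ≗σ w off)
      where
      off : ∀ x → EH.sent (action (σ x)) ≡ nothing ⊎ Graph.adj G w x ≡ Graph.adj H w x
      off x with x ≟ p
      ... | yes refl = inj₁ sentp
      ... | no x≢p   = inj₂ (same x x≢p)
    ...   | just _ with length (EH.incoming σ w) ≤ᵇ 2 in few
    ...     | true  = contradiction insensitive λ ()
    ...     | false = cong (next (σ w)) (trans
      (hear-collision _ (s≤s⁻¹ (≤-trans many (length-incoming τ≗σ w p same))))
      (sym (hear-collision _ (<⇒≤ many))))
      where
      open Receiving H ρ using (hear-collision)
      many : 3 ≤ length (EH.incoming σ w)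
      many = ≰⇒> λ ≤2 → subst T few (≤⇒≤ᵇ ≤2)

    update-agrees : ∀ {σ τ : Fin n → State} → (∀ x → τ x ≡ σ x) →
      sensitive σ u v ≡ 0 → sensitive σ v u ≡ 0 → ∀ w →
      EH.update (σ w) (action (σ w)) (EG.incoming τ w) ≡
      EH.update (σ w) (action (σ w)) (EH.incoming σ w)
    update-agrees {σ} τ≗σ uv vu w with w ≟ u | w ≟ v
    ... | yes refl | yes refl = receive τ≗σ u u (λ x x≢u →
            sym (agree u x (x≢u ∘ proj₂) (x≢u ∘ proj₂))) uv
    ... | yes refl | no u≢v   = receive τ≗σ u v (λ x x≢v →
            sym (agree u x (x≢v ∘ proj₂) (u≢v ∘ proj₁))) uv
    ... | no v≢u   | yes refl = receive τ≗σ v u (λ x x≢u →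
            sym (agree v x (v≢u ∘ proj₁) (x≢u ∘ proj₂))) vu
    ... | no w≢u   | no w≢v   = cong (EH.update (σ w) (action (σ w))) (incoming-cong τ≗σ w λ x →
            inj₂ (sym (agree w x (w≢u ∘ proj₁) (w≢v ∘ proj₁))))

    state-agrees : ∀ t →
      (∀ s → s < t → sensitive (EH.state s) u v ≡ 0 × sensitive (EH.state s) v u ≡ 0) →
      ∀ w → EG.state t w ≡ EH.state t w
    state-agrees zero    _           w = cong (λ Δ → init n Δ (ρ w)) (sym sameΔ)
    state-agrees (suc t) insensitive w = begin
      EG.update (EG.state t w) (action (EG.state t w)) (EG.incoming (EG.state t) w)
        ≡⟨ cong (λ s → EG.update s (action s) (EG.incoming (EG.state t) w)) (ih w) ⟩
      EG.update (EH.state t w) (action (EH.state t w)) (EG.incoming (EG.state t) w)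
        ≡⟨ update-≡ (EH.state t w) (action (EH.state t w)) _ ⟩
      EH.update (EH.state t w) (action (EH.state t w)) (EG.incoming (EG.state t) w)
        ≡⟨ update-agrees ih (proj₁ (insensitive t ≤-refl)) (proj₂ (insensitive t ≤-refl)) w ⟩
      EH.update (EH.state t w) (action (EH.state t w)) (EH.incoming (EH.state t) w) ∎
      where
      open ≡-Reasoning
      ih = state-agrees t λ s s<t → insensitive s (m<n⇒m<1+n s<t)

    -- The states agree at time `t`, so the execution on `G` has halted there with `k`; it has
    -- halted with `k′` at `t′`. Both outputs persist until `t′ + t`.
    same-output : ∀ {t t′ w k k′} → sensitivity t u v ≡ 0 → sensitivity t v u ≡ 0 →
      action (EH.state t w) ≡ halt k → action (EG.state t′ w) ≡ halt k′ → k ≡ k′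
    same-output {t} {t′} {w} {k} {k′} uv vu halted halted′ = halt-injective (begin
      halt k
        ≡⟨ Receiving.halt-stable G ρ t (trans (cong action agreed) halted) t′ ⟨
      action (EG.state (t′ + t) w)
        ≡⟨ cong (λ s → action (EG.state s w)) (+-comm t′ t) ⟩
      action (EG.state (t + t′) w)
        ≡⟨ Receiving.halt-stable G ρ t′ halted′ t ⟩
      halt k′ ∎)
      where
      open ≡-Reasoning
      halt-injective : ∀ {i j} → halt {Msg} i ≡ halt j → i ≡ j
      halt-injective refl = refl
      vanishes : ∀ {x y} → sensitivity t x y ≡ 0 → ∀ s → s < t → sensitive (EH.state s) x y ≡ 0
      vanishes {x} {y} ≡0 s s<t = n≤0⇒n≡0 (≤-trans
        (∈⇒≤∑ (λ s → sensitive (EH.state s) x y) (∈-downFrom⁺ s<t)) (≤-reflexive ≡0))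
      agreed : EG.state t w ≡ EH.state t w
      agreed = state-agrees t (λ s s<t → vanishes uv s s<t , vanishes vu s s<t) w

-- Realisation by unit discs.

constant : ℚᵘ → ℝ
constant q = record
  { seq    = λ _ → q
  ; cauchy = λ ε ε>0 → 0 , λ _ _ _ _ → ℚ.≤-trans
      (ℚ.≤-reflexive (ℚ.∣-∣-cong (ℚ.+-inverseʳ q))) (ℚ.<⇒≤ ε>0)
  }

data Side : Set where
  left middle right : Side

-- Unit discs centred 2 apart touch, so only the two outer ones are disjoint.
abscissa : Side → ℚᵘ
abscissa left   = ℚ.- (ℤ.+ 2 ℚ./ 1)
abscissa middle = 0ℚᵘ
abscissa right  = ℤ.+ 2 ℚ./ 1

onAxis : ℚᵘ → Point
onAxis q = constant q , constant 0ℚᵘ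

centreOf : Side → Point
centreOf s = onAxis (abscissa s)

onAxis∈Disc : ∀ q s → sqDist (onAxis q) (centreOf s) 0 ℚ.≤ 1ℚᵘ → onAxis q ∈Disc centreOf s
onAxis∈Disc q s close ε ε>0 = 0 , λ _ _ →
  ℚ.≤-trans close (ℚ.p≤p+q 1ℚᵘ ε {{ℚ.nonNegative (ℚ.<⇒≤ ε>0)}})

Opposite : Side → Side → Set
Opposite s t = (s ≡ left × t ≡ right) ⊎ (s ≡ right × t ≡ left)

Intersect : Point → Point → Set
Intersect c d = ∃[ z ] (z ∈Disc c × z ∈Disc d)

intersect-sym : ∀ {c d} → Intersect c d → Intersect d c
intersect-sym (z , z∈c , z∈d) = z , z∈d , z∈c

midpoint : Side → Side → ℚᵘ
midpoint s t = (abscissa s ℚ.+ abscissa t) ℚ.* ℚ.½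

covers? : ∀ s q → Dec (sqDist (onAxis q) (centreOf s) 0 ℚ.≤ 1ℚᵘ)
covers? s q = sqDist (onAxis q) (centreOf s) 0 ℚ.≤? 1ℚᵘ

-- The midpoint of the centres is the common point. The implicit `True` arguments have its two
-- distance bounds checked by evaluation.
meet : ∀ s t {_ : True (covers? s (midpoint s t))} {_ : True (covers? t (midpoint s t))} →
       Intersect (centreOf s) (centreOf t)
meet s t {in-s} {in-t} =
  onAxis q , onAxis∈Disc q s (toWitness in-s) , onAxis∈Disc q t (toWitness in-t)
  where
  q = midpoint s t

intersect : ∀ s t → ¬ Opposite s t → Intersect (centreOf s) (centreOf t)
intersect left   left   _    = meet left left
intersect left   middle _    = meet left middle
intersect left   right  ¬opp = contradiction (inj₁ (refl , refl)) ¬opp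
intersect middle left   _    = meet middle left
intersect middle middle _    = meet middle middle
intersect middle right  _    = meet middle right
intersect right  left   ¬opp = contradiction (inj₂ (refl , refl)) ¬opp
intersect right  middle _    = meet right middle
intersect right  right  _    = meet right right

neg-square : ∀ p → (ℚ.- p) ℚ.* (ℚ.- p) ℚ.≃ p ℚ.* p
neg-square p = ℚ.≃-trans (ℚ.≃-sym (ℚ.neg-distribˡ-* p (ℚ.- p)))
  (ℚ.≃-trans (ℚ.-‿cong (ℚ.≃-sym (ℚ.neg-distribʳ-* p p))) (ℚ.neg-involutive (p ℚ.* p)))

square-mono : ∀ {p q} .{{_ : ℚ.NonNegative p}} → p ℚ.≤ q → p ℚ.* p ℚ.≤ q ℚ.* q
square-mono p≤q = ℚ.*-mono-≤-nonNeg p≤q p≤q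

square-mono-neg : ∀ {p q} .{{_ : ℚ.NonNegative p}} → q ℚ.≤ ℚ.- p → p ℚ.* p ℚ.≤ q ℚ.* q
square-mono-neg {p} {q} q≤-p = ℚ.≤-trans
  (square-mono {p} {ℚ.- q} (ℚ.≤-respˡ-≃ (ℚ.neg-involutive p) (ℚ.neg-mono-≤ q≤-p)))
  (ℚ.≤-reflexive (neg-square q))

square-nonNeg : ∀ p → 0ℚᵘ ℚ.≤ p ℚ.* p
square-nonNeg p with ℚ.≤-total 0ℚᵘ p
... | inj₁ 0≤p = square-mono {0ℚᵘ} 0≤p
... | inj₂ p≤0 = square-mono-neg {0ℚᵘ} p≤0

private
  2ℚ = ℤ.+ 2 ℚ./ 1

far : ∀ x y → 2ℚ ℚ.* 2ℚ ℚ.≤ x ℚ.* x → ¬ (x ℚ.* x ℚ.+ y ℚ.* y ℚ.≤ 1ℚᵘ ℚ.+ 1ℚᵘ)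
far x y 4≤x² x²+y²≤2 = from-yes (¬? (2ℚ ℚ.* 2ℚ ℚ.+ 0ℚᵘ ℚ.≤? 1ℚᵘ ℚ.+ 1ℚᵘ))
  (ℚ.≤-trans (ℚ.+-mono-≤ 4≤x² (square-nonNeg y)) x²+y²≤2)

-- The sign of a real number is not decidable, that of a rational approximation is. With tolerance 1
-- a common point has approximate squared distance at most 2 to both centres from some index on; but
-- a nonnegative abscissa is at least 2 away from `-2`, and a nonpositive one from `2`, giving a
-- square of at least 4.
disjoint : ¬ Intersect (centreOf left) (centreOf right)
disjoint ((zx , zy) , z∈left , z∈right)
  with M , nearˡ ← z∈left 1ℚᵘ (from-yes (0ℚᵘ ℚ.<? 1ℚᵘ))
  with N , nearʳ ← z∈right 1ℚᵘ (from-yes (0ℚᵘ ℚ.<? 1ℚᵘ))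
  with ℚ.≤-total 0ℚᵘ (ℝ.seq zx (M ⊔ N))
... | inj₁ 0≤x = far (ℝ.seq zx (M ⊔ N) ℚ.+ 2ℚ) (ℝ.seq zy (M ⊔ N) ℚ.- 0ℚᵘ)
  (square-mono {2ℚ} (ℚ.+-monoˡ-≤ 2ℚ 0≤x)) (nearˡ (M ⊔ N) (m≤m⊔n M N))
... | inj₂ x≤0 = far (ℝ.seq zx (M ⊔ N) ℚ.- 2ℚ) (ℝ.seq zy (M ⊔ N) ℚ.- 0ℚᵘ)
  (square-mono-neg {2ℚ} (ℚ.+-monoˡ-≤ (ℚ.- 2ℚ) x≤0)) (nearʳ (M ⊔ N) (m≤n⊔m M N))

-- `u` goes to the left, `v` to the right and all others to the middle. For `u ≡ v` the first test
-- wins, no disc is on the right, and all discs meet.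
completeMinus-unitDisc : ∀ {n} (u v : Fin n) → IsUnitDisc (completeMinus u v)
completeMinus-unitDisc {n} u v = centreOf ∘ side , λ x y → mk⇔ (to x y) (from x y)
  where
  side : Fin n → Side
  side x with x ≟ u | x ≟ v
  ... | yes _ | _     = left
  ... | no _  | yes _ = right
  ... | no _  | no _  = middle

  left⇒u : ∀ x → side x ≡ left → x ≡ u
  left⇒u x eq with x ≟ u | x ≟ v | eq
  ... | yes x≡u | _     | _  = x≡u
  ... | no _    | yes _ | ()
  ... | no _    | no _  | ()

  right⇒v : ∀ x → side x ≡ right → x ≡ v
  right⇒v x eq with x ≟ u | x ≟ v | eq
  ... | no _  | yes x≡v | _  = x≡v
  ... | yes _ | _       | ()
  ... | no _  | no _    | ()

  u⇒left : side u ≡ left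
  u⇒left with u ≟ u | u ≟ v
  ... | yes _  | _ = refl
  ... | no u≢u | _ = contradiction refl u≢u

  v⇒right : u ≢ v → side v ≡ right
  v⇒right u≢v with v ≟ u | v ≟ v
  ... | yes v≡u | _      = contradiction (sym v≡u) u≢v
  ... | no _    | yes _  = refl
  ... | no _    | no v≢v = contradiction refl v≢v

  disjoint-uv : u ≢ v → ¬ Intersect (centreOf (side u)) (centreOf (side v))
  disjoint-uv u≢v rewrite u⇒left | v⇒right u≢v = disjoint

  to : ∀ x y → _ → x ≢ y × Intersect (centreOf (side x)) (centreOf (side y))
  to x y xy with x≢y , ¬uv , ¬vu ← adj⇒joined {u = u} {v} {x} {y} xy =
    x≢y , intersect (side x) (side y) λ where
      (inj₁ (l , r)) → ¬uv (left⇒u x l , right⇒v y r)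
      (inj₂ (r , l)) → ¬vu (right⇒v x r , left⇒u y l)

  from : ∀ x y → x ≢ y × Intersect (centreOf (side x)) (centreOf (side y)) → _
  from x y (x≢y , both) = joined⇒adj {u = u} {v} {x} {y}
    ( x≢y
    , (λ { (refl , refl) → disjoint-uv x≢y both })
    , (λ { (refl , refl) → disjoint-uv (x≢y ∘ sym)
        (intersect-sym {centreOf (side v)} {centreOf (side u)} both) }))

-- Bit matrices and probabilities at a fixed level.

length-cartesianProductWith : ∀ {A B C : Set} (f : A → B → C) xs ys →
  length (cartesianProductWith f xs ys) ≡ length xs * length ys
length-cartesianProductWith f []       ys = refl
length-cartesianProductWith f (x ∷ xs) ys = trans
  (length-++ (map (f x) ys))
  (cong₂ _+_ (length-map (f x) ys) (length-cartesianProductWith f xs ys))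

module _ {A : Set} where

  vectors : List A → ∀ n → List (Vec A n)
  vectors xs zero    = [] ∷ []
  vectors xs (suc n) = cartesianProductWith _∷_ xs (vectors xs n)

  ∈-vectors : ∀ {xs} → (∀ x → x ∈ xs) → ∀ {n} (v : Vec A n) → v ∈ vectors xs n
  ∈-vectors all []      = here refl
  ∈-vectors all (x ∷ v) = ∈-cartesianProductWith⁺ _∷_ (all x) (∈-vectors all v)

  vectors-unique : ∀ {xs} → Unique xs → ∀ n → Unique (vectors xs n)
  vectors-unique unique zero    = [] ∷ []
  vectors-unique unique (suc n) =
    cartesianProductWith⁺ _∷_ ∷-injective unique (vectors-unique unique n)

  length-vectors : ∀ xs n → length (vectors xs n) ≡ length xs ^ n
  length-vectors xs zero    = refl
  length-vectors xs (suc n) = trans (length-cartesianProductWith _∷_ xs (vectors xs n))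
    (cong (length xs *_) (length-vectors xs n))

  zipWith-++-injective : ∀ {k d n} {w x : Vec (Vec A k) n} {y z : Vec (Vec A d) n} →
    zipWith Vec._++_ w y ≡ zipWith Vec._++_ x z → w ≡ x × y ≡ z
  zipWith-++-injective {w = []}    {[]}    {[]}    {[]}    _  = refl , refl
  zipWith-++-injective {w = w ∷ _} {x ∷ _} {_ ∷ _} {_ ∷ _} eq
    with eq₁ , eq₂ ← ∷-injective eq
    with refl , refl ← ++-injective w x eq₁
    with refl , refl ← zipWith-++-injective eq₂ = refl , refl

tabulate-++ : ∀ {k d} (b : Bits) {y : Vec Bool k} {z : Vec Bool d} →
  tabulate (b ∘ toℕ) ≡ y Vec.++ z → tabulate {n = k} (b ∘ toℕ) ≡ y
tabulate-++ b {[]}    _  = refl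
tabulate-++ b {_ ∷ _} eq with refl , eq′ ← ∷-injective eq = cong (_ ∷_) (tabulate-++ (b ∘ suc) eq′)

prefix-++ : ∀ {n k d} (ρ : Fin n → Bits) {y : Vec (Vec Bool k) n} {z : Vec (Vec Bool d) n} →
  prefix (k + d) ρ ≡ zipWith Vec._++_ y z → prefix k ρ ≡ y
prefix-++ {zero}  ρ {[]}    {[]}    _  = refl
prefix-++ {suc n} ρ {_ ∷ _} {_ ∷ _} eq with eq₁ , eq₂ ← ∷-injective eq =
  cong₂ _∷_ (tabulate-++ (ρ zero) eq₁) (prefix-++ (ρ ∘ suc) eq₂)

bits : List Bool
bits = false ∷ true ∷ []

∈-bits : ∀ b → b ∈ bits
∈-bits false = here refl
∈-bits true  = there (here refl)

bits-unique : Unique bits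
bits-unique = ((λ ()) ∷ []) ∷ [] ∷ []

matrices : ∀ n k → List (Vec (Vec Bool k) n)
matrices n k = vectors (vectors bits k) n

∈-matrices : ∀ {n k} (x : Vec (Vec Bool k) n) → x ∈ matrices n k
∈-matrices = ∈-vectors (∈-vectors ∈-bits)

matrices-unique : ∀ n k → Unique (matrices n k)
matrices-unique n k = vectors-unique (vectors-unique bits-unique k) n

length-matrices : ∀ n k → length (matrices n k) ≡ 2 ^ (n * k)
length-matrices n k = begin
  length (vectors (vectors bits k) n)  ≡⟨ length-vectors (vectors bits k) n ⟩
  length (vectors bits k) ^ n          ≡⟨ cong (_^ n) (length-vectors bits k) ⟩
  (2 ^ k) ^ n                          ≡⟨ ^-*-assoc 2 k n ⟩
  2 ^ (k * n)                          ≡⟨ cong (2 ^_) (*-comm k n) ⟩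
  2 ^ (n * k)                          ∎
  where open ≡-Reasoning

-- Any continuation would do, because a good prefix guarantees success for all of its continuations;
-- `false` is an arbitrary filling.
extend : ∀ {k} → Vec Bool k → Bits
extend []      _       = false
extend (b ∷ _) zero    = b
extend (_ ∷ v) (suc i) = extend v i

tabulate-extend : ∀ {k} (v : Vec Bool k) → tabulate (extend v ∘ toℕ) ≡ v
tabulate-extend []      = refl
tabulate-extend (b ∷ v) = cong (b ∷_) (tabulate-extend v)

prefix-extend : ∀ {n k} (x : Vec (Vec Bool k) n) → prefix k (extend ∘ lookup x) ≡ x
prefix-extend x = trans (tabulate-cong λ v → tabulate-extend (lookup x v)) (tabulate∘lookup x)

-- Probability at least 3/4, witnessed by cylinders of the explicit level `k` and cleared of
-- fractions.
record Likely {n} (S : (Fin n → Bits) → Set) (k : ℕ) : Set where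
  field
    good          : List (Vec (Vec Bool k) n)
    unique        : Unique good
    sound         : ∀ ρ → prefix k ρ ∈ good → S ρ
    three-fourths : 3 * 2 ^ (n * k) ≤ 4 * length good

-- Each cylinder splits into `2 ^ (n * d)` cylinders of the finer level, which scales both sides of
-- the bound by the same factor.
refine : ∀ {n S k} d → Likely {n} S k → Likely S (k + d)
refine {n} {S} {k} d likely = record
  { good          = good′
  ; unique        = cartesianProductWith⁺ join zipWith-++-injective unique (matrices-unique n d)
  ; sound         = sound′
  ; three-fourths = begin
      3 * 2 ^ (n * (k + d))                       ≡⟨ cong (λ e → 3 * 2 ^ e) (*-distribˡ-+ n k d) ⟩
      3 * 2 ^ (n * k + n * d)                     ≡⟨ cong (3 *_)
                                                       (^-distribˡ-+-* 2 (n * k) (n * d)) ⟩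
      3 * (2 ^ (n * k) * 2 ^ (n * d))             ≡⟨ *-assoc 3 (2 ^ (n * k)) (2 ^ (n * d)) ⟨
      3 * 2 ^ (n * k) * 2 ^ (n * d)               ≤⟨ *-monoˡ-≤ (2 ^ (n * d)) three-fourths ⟩
      4 * length good * 2 ^ (n * d)               ≡⟨ *-assoc 4 (length good) (2 ^ (n * d)) ⟩
      4 * (length good * 2 ^ (n * d))             ≡⟨ cong (λ l → 4 * (length good * l))
                                                       (length-matrices n d) ⟨
      4 * (length good * length (matrices n d))   ≡⟨ cong (4 *_)
                                                       (length-cartesianProductWith join good _) ⟨
      4 * length good′                            ∎
  }
  where
  open Likely likely
  open ≤-Reasoning

  join : Vec (Vec Bool k) n → Vec (Vec Bool d) n → Vec (Vec Bool (k + d)) n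
  join = zipWith Vec._++_

  good′ : List (Vec (Vec Bool (k + d)) n)
  good′ = cartesianProductWith join good (matrices n d)

  sound′ : ∀ ρ → prefix (k + d) ρ ∈ good′ → S ρ
  sound′ ρ ρ∈
    with y , z , y∈ , _ , eq ← ∈-cartesianProductWith⁻ join good (matrices n d) ρ∈ =
    sound ρ (subst (_∈ good) (sym (prefix-++ ρ eq)) y∈)

reciprocal≤⅛ : ∀ d .{{_ : NonZero d}} → 8 ≤ d → (ℤ.+ 1) ℚ./ d ℚ.≤ (ℤ.+ 1) ℚ./ 8
reciprocal≤⅛ (suc d) 8≤d = *≤* (subst₂ ℤ._≤_ (ℤ.pos-* 1 8) (ℤ.pos-* 1 (suc d))
  (ℤ.+≤+ (*-monoʳ-≤ 1 8≤d)))

¾≤⇒ : ∀ l d .{{_ : NonZero d}} → (ℤ.+ 3) ℚ./ 4 ℚ.≤ (ℤ.+ l) ℚ./ d → 3 * d ≤ 4 * l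
¾≤⇒ l (suc d) (*≤* le) = subst (3 * suc d ≤_) (*-comm l 4)
  (ℤ.drop‿+≤+ (subst₂ ℤ._≤_ (sym (ℤ.pos-* 3 (suc d))) (sym (ℤ.pos-* l 4)) le))

likely : ∀ {n c S} .{{_ : NonZero n}} → 8 ≤ n → 1 ≤ c →
  ProbabilityAtLeast {n} S (1ℚᵘ ℚ.- ((ℤ.1ℤ ℚ./ (n ^ c)) {{m^n≢0 n c}})) → ∃ (Likely S)
likely {n} {c} 8≤n 1≤c whp
  -- The failure probability is at most 1/8, as `8 ≤ n ≤ n ^ c`; a tolerance of another 1/8 leaves
  -- 3/4.
  with k , good , unique , sound , large ← whp (ℤ.+ 1 ℚ./ 8) (from-yes (0ℚᵘ ℚ.<? ℤ.+ 1 ℚ./ 8)) =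
  k , record { good = good ; unique = unique ; sound = sound ; three-fourths = bound }
  where
  instance
    _ = m^n≢0 n c
    _ = m^n≢0 2 (n * k)
  8≤n^c : 8 ≤ n ^ c
  8≤n^c = ≤-trans 8≤n (≤-trans (≤-reflexive (sym (^-identityʳ n))) (^-monoʳ-≤ n 1≤c))
  ⅛ = ℤ.+ 1 ℚ./ 8
  bound : 3 * 2 ^ (n * k) ≤ 4 * length good
  bound = ¾≤⇒ (length good) (2 ^ (n * k)) (ℚ.≤-trans
    (ℚ.≤-trans (from-yes (ℤ.+ 3 ℚ./ 4 ℚ.≤? 1ℚᵘ ℚ.- ⅛ ℚ.- ⅛))
      (ℚ.+-monoˡ-≤ (ℚ.- ⅛) (ℚ.+-monoʳ-≤ 1ℚᵘ (ℚ.neg-mono-≤ (reciprocal≤⅛ (n ^ c) 8≤n^c)))))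
    large)

-- Double counting over pairs of vertices and bit matrices.

module _ {n} (3≤n : 3 ≤ n) (o : Fin n) (A : Algorithm) {b k}
  (energy≤b : EnergyAtMost A n b)
  (computes : ∀ u v → Likely (Execution.ComputesMinCut A (completeMinus {n} u v)) k)
  where

  open Algorithm A

  private
    -- The vertex `o` has two roles: as a degenerate pair it names the complete graph, and it is the
    -- device whose outputs are compared.
    K = completeMinus o o

    _≟ₘ_ : DecidableEquality (Vec (Vec Bool k) n)
    _≟ₘ_ = Vec.≡-dec (Vec.≡-dec Bool._≟_)

  open Counting _≟ₘ_

  private
    module G (u v : Fin n) = Likely (computes u v)

    ∑² : (Fin n → Fin n → ℕ) → ℕ
    ∑² f = ∑[ u ∈ allFin n ] ∑[ v ∈ allFin n ] f u v

  ∑²-const : ∀ c → ∑² (λ _ _ → c) ≡ n * (n * c)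
  ∑²-const c = trans (∑-const _ (allFin n))
    (cong₂ _*_ (length-allFin n) (trans (∑-const c (allFin n)) (cong (_* c) (length-allFin n))))

  ∑²-+ : ∀ f g → ∑² (λ u v → f u v + g u v) ≡ ∑² f + ∑² g
  ∑²-+ f g = trans
    (∑-cong (allFin n) λ u → ∑-distrib-+ (f u) (g u) (allFin n))
    (∑-distrib-+ (λ u → ∑ (allFin n) (f u)) (λ u → ∑ (allFin n) (g u)) (allFin n))

  *-distribˡ-∑² : ∀ c f → ∑² (λ u v → c * f u v) ≡ c * ∑² f
  *-distribˡ-∑² c f = trans
    (∑-cong (allFin n) λ u → *-distribˡ-∑ c (f u) (allFin n))
    (*-distribˡ-∑ c (λ u → ∑ (allFin n) (f u)) (allFin n))

  ∑²-mono : ∀ {f g} → (∀ u v → f u v ≤ g u v) → ∑² f ≤ ∑² g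
  ∑²-mono f≤g = ∑-mono (allFin n) λ u → ∑-mono (allFin n) (f≤g u)

  adj-agrees : ∀ u v (x y : Fin n) → ¬ (x ≡ u × y ≡ v) → ¬ (x ≡ v × y ≡ u) →
               Graph.adj K x y ≡ Graph.adj (completeMinus u v) x y
  adj-agrees u v x y ¬uv ¬vu = isYes-⇔
    (mk⇔ (λ (x≢y , _) → x≢y , ¬uv , ¬vu)
         (λ (x≢y , _) → adj⇒joined (completeMinus-complete o x y x≢y)))
    (joined? o o x y) (joined? u v x y)

  module _ (x : Vec (Vec Bool k) n) where

    private
      ρ : Fin n → Bits
      ρ = extend ∘ lookup x

      succeeds : ∀ u v → 0 < count x (G.good u v) → Execution.ComputesMinCut A (completeMinus u v) ρ
      succeeds u v pos = G.sound u v ρ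
        (subst (_∈ G.good u v) (sym (prefix-extend x)) (count-positive x (G.good u v) pos))

    open Receiving A K ρ using (sensitivity; ∑∑-sensitivity)

    sameΔ : ∀ u v → maxDegree K ≡ maxDegree (completeMinus u v)
    sameΔ u v = suc-injective
      (trans (completeMinus-maxDegree 3≤n o o) (sym (completeMinus-maxDegree 3≤n u v)))

    -- Success on both graphs would make `o` output the same number in both, although the minimum
    -- cut sizes differ.
    undetected : ∀ {u v t} → u ≢ v →
      (∀ w → ∃[ j ] (action (Execution.state A K ρ t w) ≡ halt j × IsMinCutSize K j)) →
      sensitivity t u v ≡ 0 → sensitivity t v u ≡ 0 → count x (G.good u v) ≡ 0
    undetected {u} {v} {t} u≢v correct uv vu with count x (G.good u v) in eq
    ... | zero  = refl
    ... | suc _ with t′ , correct′ ← succeeds u v (subst (0 <_) (sym eq) z<s)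
                with j , halted , min ← correct o
                with j′ , halted′ , min′ ← correct′ o
                with refl ← Compare.same-output A K (completeMinus u v) ρ (sameΔ u v)
                       u v (adj-agrees u v) {t} {t′} uv vu halted halted′
                = contradiction min′ (minCutSize-differs u≢v o min)

    -- If `x` is not good for `K`, each pair contributes at most 1. Otherwise a pair contributes 2
    -- only if it is degenerate or sensitive in one of its orders; the degenerate pairs add `n` and
    -- each order adds at most `n * (2 * b)`. Including the term for `K` in the sum puts both cases
    -- under one bound.
    pairs≤ : ∑² (λ u v → count x (G.good o o) + count x (G.good u v))
             ≤ n * n + n + n * (4 * b)
    pairs≤ with count x (G.good o o) in eq
    ... | zero = begin
      ∑² (λ u v → count x (G.good u v))  ≤⟨ ∑²-mono (λ u v → count-unique (G.unique u v) x) ⟩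
      ∑² (λ _ _ → 1)                     ≡⟨ ∑²-const 1 ⟩
      n * (n * 1)                        ≡⟨ cong (n *_) (*-identityʳ n) ⟩
      n * n                              ≤⟨ m≤m+n (n * n) n ⟩
      n * n + n                          ≤⟨ m≤m+n (n * n + n) _ ⟩
      n * n + n + n * (4 * b)            ∎
      where open ≤-Reasoning
    ... | suc c with t , correct ← succeeds o o (subst (0 <_) (sym eq) z<s) = begin
      ∑² (λ u v → suc c + count x (G.good u v))
        ≤⟨ ∑²-mono pointwise ⟩
      ∑² (λ u v → 1 + 𝟙 (does (v ≟ u)) + (sensitivity t u v + sensitivity t v u))
        ≡⟨ ∑²-+ (λ u v → 1 + 𝟙 (does (v ≟ u))) (λ u v → sensitivity t u v + sensitivity t v u) ⟩
      ∑² (λ u v → 1 + 𝟙 (does (v ≟ u))) + ∑² (λ u v → sensitivity t u v + sensitivity t v u)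
        ≡⟨ cong₂ _+_ (∑²-+ (λ _ _ → 1) (λ u v → 𝟙 (does (v ≟ u))))
                     (∑²-+ (sensitivity t) (λ u v → sensitivity t v u)) ⟩
      ∑² (λ _ _ → 1) + ∑² (λ u v → 𝟙 (does (v ≟ u)))
        + (∑² (sensitivity t) + ∑² (λ u v → sensitivity t v u))
        ≤⟨ +-mono-≤ (+-mono-≤ (≤-reflexive (∑²-const 1)) diagonal)
             (+-mono-≤ sensitivity≤ transposed≤) ⟩
      n * (n * 1) + n * 1 + (n * (2 * b) + n * (2 * b))
        ≡⟨ collect n b ⟩
      n * n + n + n * (4 * b) ∎
      where
      open ≤-Reasoning
      collect : ∀ n b → n * (n * 1) + n * 1 + (n * (2 * b) + n * (2 * b)) ≡ n * n + n + n * (4 * b)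
      collect = solve-∀

      sensitivity≤ : ∑² (sensitivity t) ≤ n * (2 * b)
      sensitivity≤ = ∑∑-sensitivity (completeMinus-complete o) t
        (energy≤b K (completeMinus-connected 3≤n o o , completeMinus-unitDisc o o) ρ t)

      transposed≤ : ∑² (λ u v → sensitivity t v u) ≤ n * (2 * b)
      transposed≤ = ≤-trans
        (≤-reflexive (∑-comm (λ u v → sensitivity t v u) (allFin n) (allFin n))) sensitivity≤

      diagonal : ∑² (λ u v → 𝟙 (does (v ≟ u))) ≤ n * 1
      diagonal = ≤-trans
        (∑-≤-const 1 (allFin n) (Counting.count-unique _≟_ (allFin⁺ n)))
        (≤-reflexive (cong (_* 1) (length-allFin n)))

      1+c≤1 : suc c ≤ 1
      1+c≤1 = subst (_≤ 1) eq (count-unique (G.unique o o) x)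

      both≤2 : ∀ u v → suc c + count x (G.good u v) ≤ 2
      both≤2 u v = +-mono-≤ 1+c≤1 (count-unique (G.unique u v) x)

      pointwise : ∀ u v → suc c + count x (G.good u v)
                  ≤ 1 + 𝟙 (does (v ≟ u)) + (sensitivity t u v + sensitivity t v u)
      pointwise u v with v ≟ u
      ... | yes refl = ≤-trans (both≤2 u v) (m≤m+n 2 _)
      ... | no v≢u with sensitivity t u v in uv | sensitivity t v u in vu
      ...   | zero  | zero  rewrite undetected {u} {v} {t} (v≢u ∘ sym) correct uv vu =
                ≤-trans (≤-reflexive (+-identityʳ (suc c))) 1+c≤1
      ...   | suc _ | _     = ≤-trans (both≤2 u v) (s≤s (s≤s z≤n))
      ...   | zero  | suc _ = ≤-trans (both≤2 u v) (s≤s (s≤s z≤n))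

  private
    P = 2 ^ (n * k)

    M = matrices n k

    hits : Fin n → Fin n → ℕ
    hits u v = ∑[ x ∈ M ] count x (G.good u v)

    pair : Vec (Vec Bool k) n → Fin n → Fin n → ℕ
    pair x u v = count x (G.good o o) + count x (G.good u v)

  3P≤4hits : ∀ u v → 3 * P ≤ 4 * hits u v
  3P≤4hits u v = ≤-trans (G.three-fourths u v)
    (*-monoʳ-≤ 4 (length≤∑count (G.good u v) M λ _ → ∈-matrices _))

  6P≤4∑pair : ∀ u v → 6 * P ≤ 4 * ∑[ x ∈ M ] pair x u v
  6P≤4∑pair u v = begin
    6 * P                          ≡⟨ *-distribʳ-+ P 3 3 ⟩
    3 * P + 3 * P                  ≤⟨ +-mono-≤ (3P≤4hits o o) (3P≤4hits u v) ⟩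
    4 * hits o o + 4 * hits u v    ≡⟨ *-distribˡ-+ 4 (hits o o) (hits u v) ⟨
    4 * (hits o o + hits u v)      ≡⟨ cong (4 *_) (∑-distrib-+ _ _ M) ⟨
    4 * ∑[ x ∈ M ] pair x u v      ∎
    where open ≤-Reasoning

  ∑²-∑-comm : ∑² (λ u v → ∑[ x ∈ M ] pair x u v) ≡ ∑[ x ∈ M ] ∑² (pair x)
  ∑²-∑-comm = trans
    (∑-cong (allFin n) λ u → ∑-comm (λ v x → pair x u v) (allFin n) M)
    (∑-comm (λ u x → ∑ (allFin n) (pair x u)) (allFin n) M)

  -- Each pair collects at least `6 * P / 4` over all matrices, 3/4 from each of its two graphs;
  -- each of the `P` matrices contributes at most the bound of `pairs≤`.
  averaging : n * (n * (6 * P)) ≤ 4 * (P * (n * n + n + n * (4 * b)))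
  averaging = begin
    n * (n * (6 * P))
      ≡⟨ ∑²-const (6 * P) ⟨
    ∑² (λ _ _ → 6 * P)
      ≤⟨ ∑²-mono 6P≤4∑pair ⟩
    ∑² (λ u v → 4 * ∑[ x ∈ M ] pair x u v)
      ≡⟨ *-distribˡ-∑² 4 (λ u v → ∑[ x ∈ M ] pair x u v) ⟩
    4 * ∑² (λ u v → ∑[ x ∈ M ] pair x u v)
      ≡⟨ cong (4 *_) ∑²-∑-comm ⟩
    4 * ∑[ x ∈ M ] ∑² (pair x)
      ≤⟨ *-monoʳ-≤ 4 (∑-≤-const (n * n + n + n * (4 * b)) M pairs≤) ⟩
    4 * (length M * (n * n + n + n * (4 * b)))
      ≡⟨ cong (λ l → 4 * (l * (n * n + n + n * (4 * b)))) (length-matrices n k) ⟩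
    4 * (P * (n * n + n + n * (4 * b))) ∎
    where open ≤-Reasoning

-- Final arithmetic and choice of constants.

average⇒n≤16b : ∀ {n P} b .{{_ : NonZero n}} .{{_ : NonZero P}} → 4 ≤ n →
  n * (n * (6 * P)) ≤ 4 * (P * (n * n + n + n * (4 * b))) → n ≤ 16 * b
-- Cancelling `n * P * 2` leaves `3 * n ≤ 2 * n + 2 + 8 * b`. After doubling, the constant 4 is
-- absorbed by `4 ≤ n`.
average⇒n≤16b {n} {P} b 4≤n averaged = +-cancelˡ-≤ (5 * n) n (16 * b) (begin
  5 * n + n                   ≡⟨ double n ⟩
  2 * (3 * n)                 ≤⟨ *-monoʳ-≤ 2 cancelled ⟩
  2 * (2 * n + 2 + 8 * b)     ≡⟨ expand n b ⟩
  4 * n + 4 + 16 * b          ≤⟨ +-monoˡ-≤ (16 * b) (+-monoʳ-≤ (4 * n) 4≤n) ⟩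
  4 * n + n + 16 * b          ≡⟨ cong (_+ 16 * b) (+-comm (4 * n) n) ⟩
  5 * n + 16 * b              ∎)
  where
  open ≤-Reasoning
  left-side : ∀ n P → n * (n * (6 * P)) ≡ n * P * 2 * (3 * n)
  left-side = solve-∀
  right-side : ∀ n P b → 4 * (P * (n * n + n + n * (4 * b))) ≡ n * P * 2 * (2 * n + 2 + 8 * b)
  right-side = solve-∀
  double : ∀ n → 5 * n + n ≡ 2 * (3 * n)
  double = solve-∀
  expand : ∀ n b → 2 * (2 * n + 2 + 8 * b) ≡ 4 * n + 4 + 16 * b
  expand = solve-∀
  cancelled : 3 * n ≤ 2 * n + 2 + 8 * b
  cancelled = *-cancelˡ-≤ (n * P * 2) {{m*n≢0 (n * P) 2 {{m*n≢0 n P}}}}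
    (subst₂ _≤_ (left-side n P) (right-side n P b) averaged)

theorem1p5 : (A : Algorithm) → ComputesMinCutWhp A → EnergyΩn A
-- From `N` on the algorithm is correct with high probability; 8 makes that probability at least 7/8
-- and also supplies the third vertex and `4 ≤ n`.
theorem1p5 A (c , 1≤c , N , whp) = 16 , s≤s z≤n , N ⊔ 8 , bound
  where
  bound : ∀ n → n ≥ N ⊔ 8 → ∀ b → EnergyAtMost A n b → n ≤ 16 * b
  bound n n≥ b energy≤b = average⇒n≤16b {P = 2 ^ (n * top)} b (≤-trans (m≤m+n 4 4) 8≤n)
    (averaging (≤-trans (m≤m+n 3 5) 8≤n) (fromℕ< 8≤n) A energy≤b common)
    where
    N≤n : N ≤ n
    N≤n = ≤-trans (m≤m⊔n N 8) n≥

    8≤n : 8 ≤ n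
    8≤n = ≤-trans (m≤n⊔m N 8) n≥

    instance
      n≢0 : NonZero n
      n≢0 = >-nonZero (≤-trans z<s 8≤n)

    success : ∀ u v → ∃ (Likely (Execution.ComputesMinCut A (completeMinus {n} u v)))
    success u v = likely 8≤n 1≤c (whp n N≤n (completeMinus u v)
      (completeMinus-connected (≤-trans (m≤m+n 3 5) 8≤n) u v , completeMinus-unitDisc u v))

    level : Fin n → Fin n → ℕ
    level u v = proj₁ (success u v)

    -- Every graph comes with its own number of inspected bits. The sum is a crude common upper
    -- bound, to which all of them are refined so that their matrices can be counted together.
    top : ℕ
    top = ∑[ u ∈ allFin n ] ∑[ v ∈ allFin n ] level u v

    level≤top : ∀ u v → level u v ≤ top
    level≤top u v = ≤-trans (∈⇒≤∑ (level u) (∈-allFin v))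
                            (∈⇒≤∑ (λ u → ∑ (allFin n) (level u)) (∈-allFin u))

    common : ∀ u v → Likely (Execution.ComputesMinCut A (completeMinus u v)) top
    common u v = subst (Likely _) (m+[n∸m]≡n (level≤top u v))
      (refine (top ∸ level u v) (proj₂ (success u v)))

    instance
      2^≢0 : NonZero (2 ^ (n * top))
      2^≢0 = m^n≢0 2 (n * top)
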